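{- Let $k_0$ be a nonzero integer satisfying at least one of the following congruences: $k_0 \equiv 1 \pmod 2$; $k_0 \equiv 1,2 \pmod 3$; $k_0 \equiv 2,3 \pmod 5$; $k_0 \equiv 1,2,5,6 \pmod 7$; $k_0 \equiv 1,2,5,6,9,10 \pmod{11}$; $k_0 \equiv 3,6,7,10 \pmod{13}$; $k_0 \equiv 1,3,14,16 \pmod{17}$; $k_0 \equiv 6,7,9,10,12,13 \pmod{19}$; $k_0 \equiv 1,6,8,9,14,15,17,22 \pmod{23}$; $k_0 \equiv 2,11,12,14,15,17,18,27 \pmod{29}$; $k_0 \equiv 6,10,11,14,17,20,21,25 \pmod{31}$; $k_0 \equiv 6,8,10,11,14,17,18,19,20,23,26,27,29,31 \pmod{37}$; $k_0 \equiv 2,11,13,14,15,26,27,28,30,39 \pmod{41}$; $k_0 \equiv 4,5,12,14,17,21,22,26,29,31,38,39 \pmod{43}$; $k_0 \equiv 4,7,11,12,15,19,21,26,28,32,35,36,40,43 \pmod{47}$; $k_0 \equiv 2,19,22,25,26,27,28,31,34,51 \pmod{53}$; $k_0 \equiv 1,3,7,8,51,25,29,30,34,52,56,58 \pmod{59}$; $k_0 \equiv 1,2,3,12,17,24,29,30,31,32,37,44,49,58,59,60 \pmod{61}$; $k_0 \equiv 5,6,9,15,18,22,27,30,32,33,34,35,37,40,45,49,52,58,61,62 \pmod{67}$; $k_0 \equiv 6,7,11,12,16,20,27,28,30,33,38,41,43,44,51,55,59,60,64,65 \pmod{71}$; $k_0 \equiv 6,7,12,13,14,20,24,29,32,33,40,41,44,49,53,59,60,61,66,67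 \pmod{73}$; $k_0 \equiv 20,68 \pmod{79}$; $k_0 \equiv 12,16,21,62,71 \pmod{83}$; $k_0 \equiv 9,50 \pmod{103}$; $k_0 \equiv 106 \pmod{107}$; $k_0 \equiv 92 \pmod{109}$; $k_0 \equiv 26,105 \pmod{131}$; $k_0 \equiv 89 \pmod{149}$; $k_0 \equiv 24 \pmod{157}$; $k_0 \equiv 19 \pmod{173}$; $k_0 \equiv 52,145 \pmod{197}$. Then $\delta_n(k_0)$ is not a perfect square for every $n \geq 1$. Moreover, $\delta_n(k_0)$ is not a perfect square for every $n \geq 1$ and every integer $k_0$ with $1 \leq |k_0| \leq 10^6$.
   Context: The polynomials $\delta_n, \varepsilon_n \in \mathbb{Z}[k]$, $n \geq 1$, are defined by $(\delta_1(k),\varepsilon_1(k)) = (2k^2, k)$ and, for $n \geq 2$, $\delta_n(k) = \delta_{n-1}(k)^2 + \varepsilon_{n-1}(k)^2$, $\varepsilon_n(k) = \delta_{n-1}(k)\varepsilon_{n-1}(k)/k$. -}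

module Defs where

open import Data.Nat using (ℕ; zero; suc)
open import Data.Integer using (ℤ; +_; _*_; _+_; 0ℤ; ≢-nonZero)
open import Data.Integer.DivMod using (_/_; _%ℕ_)
open import Data.Product using (_×_; _,_; proj₁; proj₂; Σ; ∃)
open import Data.List using (List; []; _∷_)
open import Data.List.Membership.Propositional using (_∈_)
open import Data.List.Relation.Unary.Any using (Any)
open import Relation.Binary.PropositionalEquality using (_≡_; _≢_)
open import Data.Empty using (⊥)

-- (δ_n(k), ε_n(k)) evaluated at an integer k ≠ 0, for n ≥ 1.
-- Index convention: δε k h (suc m) = (δ_{m+1}(k), ε_{m+1}(k)).
-- The index 0 value is an unused junk value (the sequence starts at n = 1).
-- The polynomial division by k in the definition of ε_n is rendered as the
-- (exact) integer division by k ≠ 0 at the evaluation point.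
δε : (k : ℤ) → k ≢ 0ℤ → ℕ → ℤ × ℤ
δε k h zero = 0ℤ , 0ℤ
δε k h (suc zero) = (+ 2) * (k * k) , k
δε k h (suc (suc m)) with δε k h (suc m)
... | d , e = d * d + e * e , ((d * e) / k) {{≢-nonZero h}}

δ : (k : ℤ) → k ≢ 0ℤ → ℕ → ℤ
δ k h n = proj₁ (δε k h n)

ε : (k : ℤ) → k ≢ 0ℤ → ℕ → ℤ
ε k h n = proj₂ (δε k h n)

IsSquare : ℤ → Set
IsSquare x = ∃ λ (m : ℤ) → m * m ≡ x

congruenceTable : List (ℕ × List ℕ)
congruenceTable =
    (2 , 1 ∷ [])
  ∷ (3 , 1 ∷ 2 ∷ [])
  ∷ (5 , 2 ∷ 3 ∷ [])
  ∷ (7 , 1 ∷ 2 ∷ 5 ∷ 6 ∷ [])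
  ∷ (11 , 1 ∷ 2 ∷ 5 ∷ 6 ∷ 9 ∷ 10 ∷ [])
  ∷ (13 , 3 ∷ 6 ∷ 7 ∷ 10 ∷ [])
  ∷ (17 , 1 ∷ 3 ∷ 14 ∷ 16 ∷ [])
  ∷ (19 , 6 ∷ 7 ∷ 9 ∷ 10 ∷ 12 ∷ 13 ∷ [])
  ∷ (23 , 1 ∷ 6 ∷ 8 ∷ 9 ∷ 14 ∷ 15 ∷ 17 ∷ 22 ∷ [])
  ∷ (29 , 2 ∷ 11 ∷ 12 ∷ 14 ∷ 15 ∷ 17 ∷ 18 ∷ 27 ∷ [])
  ∷ (31 , 6 ∷ 10 ∷ 11 ∷ 14 ∷ 17 ∷ 20 ∷ 21 ∷ 25 ∷ [])
  ∷ (37 , 6 ∷ 8 ∷ 10 ∷ 11 ∷ 14 ∷ 17 ∷ 18 ∷ 19 ∷ 20 ∷ 23 ∷ 26 ∷ 27 ∷ 29 ∷ 31 ∷ [])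
  ∷ (41 , 2 ∷ 11 ∷ 13 ∷ 14 ∷ 15 ∷ 26 ∷ 27 ∷ 28 ∷ 30 ∷ 39 ∷ [])
  ∷ (43 , 4 ∷ 5 ∷ 12 ∷ 14 ∷ 17 ∷ 21 ∷ 22 ∷ 26 ∷ 29 ∷ 31 ∷ 38 ∷ 39 ∷ [])
  ∷ (47 , 4 ∷ 7 ∷ 11 ∷ 12 ∷ 15 ∷ 19 ∷ 21 ∷ 26 ∷ 28 ∷ 32 ∷ 35 ∷ 36 ∷ 40 ∷ 43 ∷ [])
  ∷ (53 , 2 ∷ 19 ∷ 22 ∷ 25 ∷ 26 ∷ 27 ∷ 28 ∷ 31 ∷ 34 ∷ 51 ∷ [])
  ∷ (59 , 1 ∷ 3 ∷ 7 ∷ 8 ∷ 51 ∷ 25 ∷ 29 ∷ 30 ∷ 34 ∷ 52 ∷ 56 ∷ 58 ∷ [])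
  ∷ (61 , 1 ∷ 2 ∷ 3 ∷ 12 ∷ 17 ∷ 24 ∷ 29 ∷ 30 ∷ 31 ∷ 32 ∷ 37 ∷ 44 ∷ 49 ∷ 58 ∷ 59 ∷ 60 ∷ [])
  ∷ (67 , 5 ∷ 6 ∷ 9 ∷ 15 ∷ 18 ∷ 22 ∷ 27 ∷ 30 ∷ 32 ∷ 33 ∷ 34 ∷ 35 ∷ 37 ∷ 40 ∷ 45 ∷ 49 ∷ 52 ∷ 58 ∷ 61 ∷ 62 ∷ [])
  ∷ (71 , 6 ∷ 7 ∷ 11 ∷ 12 ∷ 16 ∷ 20 ∷ 27 ∷ 28 ∷ 30 ∷ 33 ∷ 38 ∷ 41 ∷ 43 ∷ 44 ∷ 51 ∷ 55 ∷ 59 ∷ 60 ∷ 64 ∷ 65 ∷ [])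
  ∷ (73 , 6 ∷ 7 ∷ 12 ∷ 13 ∷ 14 ∷ 20 ∷ 24 ∷ 29 ∷ 32 ∷ 33 ∷ 40 ∷ 41 ∷ 44 ∷ 49 ∷ 53 ∷ 59 ∷ 60 ∷ 61 ∷ 66 ∷ 67 ∷ [])
  ∷ (79 , 20 ∷ 68 ∷ [])
  ∷ (83 , 12 ∷ 16 ∷ 21 ∷ 62 ∷ 71 ∷ [])
  ∷ (103 , 9 ∷ 50 ∷ [])
  ∷ (107 , 106 ∷ [])
  ∷ (109 , 92 ∷ [])
  ∷ (131 , 26 ∷ 105 ∷ [])
  ∷ (149 , 89 ∷ [])
  ∷ (157 , 24 ∷ [])
  ∷ (173 , 19 ∷ [])
  ∷ (197 , 52 ∷ 145 ∷ [])
  ∷ []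

-- k satisfies the congruence for modulus p with residue set rs.
-- (Moduli are positive; the residue of k mod p is taken in {0,…,p-1}.)
SatisfiesEntry : ℤ → ℕ × List ℕ → Set
SatisfiesEntry k (zero , rs) = ⊥
SatisfiesEntry k (suc q , rs) = (k %ℕ suc q) ∈ rs

SatisfiesSomeCongruence : ℤ → Set
SatisfiesSomeCongruence k = Any (SatisfiesEntry k) congruenceTable

{-# OPTIONS --safe #-}
-- Write K = k². At the even indices n = 2m + 2 the pair (δ_n, ε_n) is t² (a_m, b_m) for some t ≠ 0,
-- where (a_0, b_0) = (4K + 1, 2), a_{m+1} = K (a² + b²)² + (ab)² and b_{m+1} = (a² + b²) ab, and
-- then δ_{n+1} = t⁴ (a² + b²). So only a_m and a_m² + b_m² have to be shown to be nonsquares.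
-- For a_m² + b_m² this holds modulo 3 for every k. For m = 0, 1, 2 the polynomial a_m(k) is squeezed
-- between consecutive squares as soon as k is large, its truncated square root having integer
-- coefficients. For m ≥ 3 the orbit of (a_m, b_m) modulo p is finite, so it suffices that
-- its first coordinate never meets a square. This condition depends on K modulo p only. It holds
-- for all the congruences with odd p, while odd k are settled modulo 8, and it holds for enough
-- pairs (p, K mod p) to cover 1 ≤ |k| ≤ 10⁶.
module Submission where

open import Defs
open import Data.Bool using (Bool; true; false; T; not; _∧_; _∨_; if_then_else_)
open import Data.Bool.ListAction using (any; all)
open import Data.Bool.Properties using (T-∧; T-∨; T-not-≡)
open import Data.Empty using (⊥-elim)
open import Data.Integer using (ℤ; +_; -[1+_]; 0ℤ; ∣_∣; ≢-nonZero)
import Data.Integer as ℤ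
import Data.Integer.DivMod as ℤ/
import Data.Integer.Properties as ℤₚ
import Data.Integer.Tactic.RingSolver as ℤ-Ring
open import Data.List using (List; []; _∷_; drop)
open import Data.List.Membership.Propositional using (_∈_)
open import Data.List.Relation.Unary.All using (All; []; _∷_)
import Data.List.Relation.Unary.All as All
open import Data.List.Relation.Unary.All.Properties using (all⁺)
open import Data.List.Relation.Unary.Any using (Any; here; there)
import Data.List.Relation.Unary.Any as Any
open import Data.List.Relation.Unary.Any.Properties using (any⁻)
open import Data.Nat hiding (≢-nonZero)
import Data.Nat as ℕ
open import Data.Nat.Coprimality using (Coprime; coprime-divisor; coprime-/gcd)
open import Data.Nat.Divisibility using (_∣_; divides; divides-refl; ∣-refl; ∣-trans; m∣m*n; *-cancelʳ-∣)
open import Data.Nat.DivMod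
open import Data.Nat.GCD using (gcd; gcd[m,n]∣m; gcd[m,n]∣n; gcd[m,n]≢0)
open import Data.Nat.GeneralisedArithmetic using (fold; fold-+)
open import Data.Nat.Properties
open import Data.Nat.Tactic.RingSolver using (solve-∀)
open import Data.Product using (_×_; _,_; proj₁; proj₂; ∃; map₂)
open import Data.Sum using (_⊎_; inj₁; inj₂; [_,_]′)
open import Data.Unit using (tt)
open import Function using (_∘_; Equivalence)
open import Relation.Nullary using (¬_; yes; no)
open import Relation.Binary.PropositionalEquality

-- Squares and bounded Boolean checks.

Squareℕ : ℕ → Set
Squareℕ x = ∃ λ c → c * c ≡ x

T-∧⁻ : ∀ {x y} → T (x ∧ y) → T x × T y
T-∧⁻ = Equivalence.to T-∧

T-∨⁻ : ∀ {x y} → T (x ∨ y) → T x ⊎ T y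
T-∨⁻ = Equivalence.to T-∨

allBelow : (ℕ → Bool) → ℕ → Bool
allBelow p zero    = true
allBelow p (suc n) = p n ∧ allBelow p n

allBelow-sound : ∀ p n → T (allBelow p n) → ∀ i → i < n → T (p i)
allBelow-sound p (suc n) h i (s≤s i≤n) with T-∧⁻ {p n} h
... | pn , ps with m≤n⇒m<n∨m≡n i≤n
...   | inj₁ i<n  = allBelow-sound p n ps i i<n
...   | inj₂ refl = pn

-- Orbits in a finite set

module _ {A : Set} (_==_ : A → A → Bool) (next : A → A) (test : A → Bool) where

  -- Meeting a seen element ends the search with success, as the orbit repeats from there. Running
  -- out of fuel counts as failure, so success always certifies the whole orbit.
  testOrbit : ℕ → List A → A → Bool
  testOrbit zero       seen x = false
  testOrbit (suc fuel) seen x =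
    if any (x ==_) seen then true else test x ∧ testOrbit fuel (x ∷ seen) (next x)

  private
    Closed : List A → List A → Set
    Closed xs ys = All (λ y → T (test y) × next y ∈ ys) xs

    closed⇒test : ∀ {xs} → Closed xs xs → ∀ {x} → x ∈ xs → ∀ m → T (test (fold x next m)) × fold x next m ∈ xs
    closed⇒test c x∈ zero    = proj₁ (All.lookup c x∈) , x∈
    closed⇒test c x∈ (suc m) with All.lookup c (proj₂ (closed⇒test c x∈ m))
    ... | _ , y∈ = proj₁ (All.lookup c y∈) , y∈

    fold-next : ∀ x m → fold x next (suc m) ≡ fold (next x) next m
    fold-next x zero    = refl
    fold-next x (suc m) = cong next (fold-next x m)

  -- Invariant: every seen element has passed the test, and its successor is seen or is the current
  -- `x`. Once `x` itself has been seen, `seen` is closed under `next` and contains the rest of the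
  -- orbit.
  testOrbit-sound : (∀ {x y} → T (x == y) → x ≡ y) →
    ∀ fuel seen x → Closed seen (x ∷ seen) → T (testOrbit fuel seen x) →
    ∀ m → T (test (fold x next m))
  testOrbit-sound ==⇒≡ (suc fuel) seen x c h m with any (x ==_) seen in eq
  ... | true  = proj₁ (closed⇒test (All.map (map₂ shrink) c) x∈ m)
    where
    x∈ : x ∈ seen
    x∈ = Any.map ==⇒≡ (any⁻ (x ==_) seen (subst T (sym eq) tt))
    shrink : ∀ {y} → y ∈ x ∷ seen → y ∈ seen
    shrink (here refl) = x∈
    shrink (there y∈)  = y∈
  ... | false with T-∧⁻ {test x} h | m
  ...   | tx , _ | zero   = tx
  ...   | tx , h | suc m′ = subst (T ∘ test) (sym (fold-next x m′))
    (testOrbit-sound ==⇒≡ fuel (x ∷ seen) (next x) ((tx , here refl) ∷ All.map (map₂ there) c) h m′)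

-- The recurrence and its residues

step : ℕ → ℕ × ℕ → ℕ × ℕ
step K (a , b) = K * (s * s) + (a * b) * (a * b) , s * (a * b)
  where s = a * a + b * b

initial : ℕ → ℕ × ℕ
initial K = 4 * K + 1 , 2

state : ℕ → ℕ → ℕ × ℕ
state K = fold (initial K) (step K)

norm : ℕ × ℕ → ℕ
norm (a , b) = a * a + b * b

module Residues (n : ℕ) .{{_ : NonZero n}} where

  infix 4 _≈_
  _≈_ : ℕ → ℕ → Set
  x ≈ y = x % n ≡ y % n

  ≈-% : ∀ x → x ≈ x % n
  ≈-% x = sym (m%n%n≡m%n x n)

  +-cong-≈ : ∀ {x x′ y y′} → x ≈ x′ → y ≈ y′ → x + y ≈ x′ + y′
  +-cong-≈ {x} {x′} {y} {y′} p q = begin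
    (x + y) % n             ≡⟨ %-distribˡ-+ x y n ⟩
    (x % n + y % n) % n     ≡⟨ cong₂ (λ u v → (u + v) % n) p q ⟩
    (x′ % n + y′ % n) % n   ≡⟨ sym (%-distribˡ-+ x′ y′ n) ⟩
    (x′ + y′) % n           ∎
    where open ≡-Reasoning

  *-cong-≈ : ∀ {x x′ y y′} → x ≈ x′ → y ≈ y′ → x * y ≈ x′ * y′
  *-cong-≈ {x} {x′} {y} {y′} p q = begin
    (x * y) % n               ≡⟨ %-distribˡ-* x y n ⟩
    ((x % n) * (y % n)) % n   ≡⟨ cong₂ (λ u v → (u * v) % n) p q ⟩
    ((x′ % n) * (y′ % n)) % n ≡⟨ sym (%-distribˡ-* x′ y′ n) ⟩
    (x′ * y′) % n             ∎
    where open ≡-Reasoning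

  -- The residue of a square depends only on the residue of its root, so trying `n` roots is
  -- exhaustive.
  nonSquare : ℕ → Bool
  nonSquare x = allBelow (λ y → not (y * y % n ≡ᵇ r)) n
    where r = x % n

  nonSquare-sound : ∀ {x y} → T (nonSquare x) → y ≈ x → ¬ Squareℕ y
  nonSquare-sound {x} {y} h y≈x (c , refl) =
    subst T (Equivalence.to T-not-≡ (allBelow-sound _ n h (c % n) (m%n<n c n)))
      (≡⇒≡ᵇ _ (x % n) (trans (sym (%-distribˡ-* c c n)) y≈x))

  stepMod : ℕ → ℕ × ℕ → ℕ × ℕ
  stepMod K (a , b) = (K * (s * s) + (a * b) * (a * b)) % n , s * (a * b) % n
    where s = (a * a + b * b) % n

  initialMod : ℕ → ℕ × ℕ
  initialMod K = (4 * K + 1) % n , 2 % n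

  _≈²_ : ℕ × ℕ → ℕ × ℕ → Set
  (a , b) ≈² (c , d) = a ≈ c × b ≈ d

  norm-cong : ∀ {z w} → z ≈² w → norm z ≈ norm w
  norm-cong (p , q) = +-cong-≈ (*-cong-≈ p p) (*-cong-≈ q q)

  initial≈ : ∀ {K r} → K ≈ r → initial K ≈² initialMod r
  initial≈ {K} {r} p = trans (+-cong-≈ {y = 1} (*-cong-≈ {4} refl p) refl) (≈-% (4 * r + 1)) , ≈-% 2

  step≈ : ∀ {K r z w} → K ≈ r → z ≈² w → step K z ≈² stepMod r w
  step≈ {K} {r} {a , b} {c , d} p (q₁ , q₂) =
    trans (+-cong-≈ (*-cong-≈ p (*-cong-≈ s≈ s≈)) (*-cong-≈ ab≈ ab≈)) (≈-% _) ,
    trans (*-cong-≈ s≈ ab≈) (≈-% _)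
    where
    s≈ : a * a + b * b ≈ (c * c + d * d) % n
    s≈ = trans (norm-cong (q₁ , q₂)) (≈-% _)
    ab≈ : a * b ≈ c * d
    ab≈ = *-cong-≈ q₁ q₂

  state≈ : ∀ {K r} → K ≈ r → ∀ m → state K m ≈² fold (initialMod r) (stepMod r) m
  state≈ p zero    = initial≈ p
  state≈ p (suc m) = step≈ p (state≈ p m)

  _==_ : ℕ × ℕ → ℕ × ℕ → Bool
  (a , b) == (c , d) = (a ≡ᵇ c) ∧ (b ≡ᵇ d)

  ==⇒≡ : ∀ {z w} → T (z == w) → z ≡ w
  ==⇒≡ {a , b} {c , d} h with T-∧⁻ {a ≡ᵇ c} h
  ... | p , q = cong₂ _,_ (≡ᵇ⇒≡ a c p) (≡ᵇ⇒≡ b d q)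

  -- There are n² states modulo n, so the fuel suffices for the orbit to close.
  nonSquareFrom : ℕ → (ℕ × ℕ → ℕ) → ℕ → Bool
  nonSquareFrom j f r =
    testOrbit _==_ (stepMod r) (nonSquare ∘ f) (suc (n * n)) [] (fold (initialMod r) (stepMod r) j)

  nonSquareFrom-sound : ∀ j f → (∀ {z w} → z ≈² w → f z ≈ f w) → ∀ {K r} → K ≈ r →
    T (nonSquareFrom j f r) → ∀ m → ¬ Squareℕ (f (state K (m + j)))
  nonSquareFrom-sound j f f-cong {K} {r} p h m =
    nonSquare-sound (subst (T ∘ nonSquare ∘ f) (sym (fold-+ _ (stepMod r) m)) test)
      (f-cong (state≈ p (m + j)))
    where
    test : T (nonSquare (f (fold (fold (initialMod r) (stepMod r) j) (stepMod r) m)))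
    test = testOrbit-sound _==_ (stepMod r) (nonSquare ∘ f) ==⇒≡ (suc (n * n)) [] _ [] h m

-- The first three even indices

-- Coefficients in increasing order of degree.
Poly : Set
Poly = List ℕ

infixl 6 _+ᵖ_
infixl 7 _*ᵖ_ _·ᵖ_
infix 4 _≤ᵖ_

eval : ℕ → Poly → ℕ
eval x []      = 0
eval x (a ∷ p) = a + x * eval x p

_+ᵖ_ : Poly → Poly → Poly
[]      +ᵖ q       = q
(a ∷ p) +ᵖ []      = a ∷ p
(a ∷ p) +ᵖ (b ∷ q) = (a + b) ∷ (p +ᵖ q)

_·ᵖ_ : ℕ → Poly → Poly
a ·ᵖ []      = []
a ·ᵖ (b ∷ q) = (a * b) ∷ (a ·ᵖ q)

_*ᵖ_ : Poly → Poly → Poly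
[]      *ᵖ q = []
(a ∷ p) *ᵖ q = a ·ᵖ q +ᵖ (0 ∷ p *ᵖ q)

_∘ᵖ_ : Poly → Poly → Poly
[]      ∘ᵖ q = []
(a ∷ p) ∘ᵖ q = (a ∷ []) +ᵖ q *ᵖ (p ∘ᵖ q)

-- Coefficientwise comparison is sufficient, not necessary, for an inequality at all natural
-- arguments. An inequality that holds only from some `c` on can pass after the substitution
-- `k = c + x`.
_≤ᵖ_ : Poly → Poly → Bool
[]      ≤ᵖ q       = true
(a ∷ p) ≤ᵖ []      = (a ≡ᵇ 0) ∧ (p ≤ᵖ [])
(a ∷ p) ≤ᵖ (b ∷ q) = (a ≤ᵇ b) ∧ (p ≤ᵖ q)

eval-+ : ∀ x p q → eval x (p +ᵖ q) ≡ eval x p + eval x q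
eval-+ x []      q       = refl
eval-+ x (a ∷ p) []      = sym (+-identityʳ _)
eval-+ x (a ∷ p) (b ∷ q) rewrite eval-+ x p q = lemma a b x (eval x p) (eval x q)
  where
  lemma : ∀ a b x u v → a + b + x * (u + v) ≡ a + x * u + (b + x * v)
  lemma = solve-∀

eval-· : ∀ x a q → eval x (a ·ᵖ q) ≡ a * eval x q
eval-· x a []      = sym (*-zeroʳ a)
eval-· x a (b ∷ q) rewrite eval-· x a q = lemma a b x (eval x q)
  where
  lemma : ∀ a b x u → a * b + x * (a * u) ≡ a * (b + x * u)
  lemma = solve-∀

eval-* : ∀ x p q → eval x (p *ᵖ q) ≡ eval x p * eval x q
eval-* x []      q = refl
eval-* x (a ∷ p) q rewrite eval-+ x (a ·ᵖ q) (0 ∷ p *ᵖ q) | eval-· x a q | eval-* x p q =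
  lemma a x (eval x p) (eval x q)
  where
  lemma : ∀ a x u v → a * v + x * (u * v) ≡ (a + x * u) * v
  lemma = solve-∀

eval-≤ : ∀ x p q → T (p ≤ᵖ q) → eval x p ≤ eval x q
eval-≤ x []      q       h = z≤n
eval-≤ x (a ∷ p) []      h with T-∧⁻ {a ≡ᵇ 0} h
... | a≡0 , p≤[] = ≤-reflexive (cong₂ _+_ (≡ᵇ⇒≡ a 0 a≡0)
  (trans (cong (x *_) (n≤0⇒n≡0 (eval-≤ x p [] p≤[]))) (*-zeroʳ x)))
eval-≤ x (a ∷ p) (b ∷ q) h with T-∧⁻ {a ≤ᵇ b} h
... | a≤b , p≤q = +-mono-≤ (≤ᵇ⇒≤ a b a≤b) (*-monoʳ-≤ x (eval-≤ x p q p≤q))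

stepᵖ : Poly → Poly × Poly → Poly × Poly
stepᵖ K (a , b) = K *ᵖ (s *ᵖ s) +ᵖ a *ᵖ b *ᵖ (a *ᵖ b) , s *ᵖ (a *ᵖ b)
  where s = a *ᵖ a +ᵖ b *ᵖ b

stateᵖ : Poly → ℕ → Poly × Poly
stateᵖ K = fold (4 ·ᵖ K +ᵖ (1 ∷ []) , 2 ∷ []) (stepᵖ K)

eval-step : ∀ x K a b → let (u , v) = stepᵖ K (a , b) in
  (eval x u , eval x v) ≡ step (eval x K) (eval x a , eval x b)
eval-step x K a b
  rewrite eval-+ x (K *ᵖ ((a *ᵖ a +ᵖ b *ᵖ b) *ᵖ (a *ᵖ a +ᵖ b *ᵖ b))) (a *ᵖ b *ᵖ (a *ᵖ b))
        | eval-* x K ((a *ᵖ a +ᵖ b *ᵖ b) *ᵖ (a *ᵖ a +ᵖ b *ᵖ b))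
        | eval-* x (a *ᵖ a +ᵖ b *ᵖ b) (a *ᵖ a +ᵖ b *ᵖ b)
        | eval-* x (a *ᵖ a +ᵖ b *ᵖ b) (a *ᵖ b)
        | eval-+ x (a *ᵖ a) (b *ᵖ b)
        | eval-* x (a *ᵖ b) (a *ᵖ b)
        | eval-* x a b | eval-* x a a | eval-* x b b = refl

eval-state : ∀ x K m → let (u , v) = stateᵖ K m in (eval x u , eval x v) ≡ state (eval x K) m
eval-state x K zero    = cong₂ _,_
  (trans (eval-+ x (4 ·ᵖ K) (1 ∷ [])) (cong₂ _+_ (eval-· x 4 K) (cong suc (*-zeroʳ x))))
  (cong (suc ∘ suc) (*-zeroʳ x))
eval-state x K (suc m) =
  trans (eval-step x K (proj₁ (stateᵖ K m)) (proj₂ (stateᵖ K m))) (cong (step (eval x K)) (eval-state x K m))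

-- The second hypothesis is `(z - 1)² < y` without subtraction. A root `c` with `z = c + 1 + d`
-- contradicts it because `(c + d)² - c² = 2cd + d²` is nonnegative; a root `c ≥ z` contradicts the
-- first.
between-squares : ∀ {z y} → y < z * z → z * z + 1 < y + 2 * z → ¬ Squareℕ y
between-squares {z} y<z² gap (c , refl) with c <? z
... | no c≮z = <⇒≱ y<z² (*-mono-≤ (≮⇒≥ c≮z) (≮⇒≥ c≮z))
... | yes c<z with m≤n⇒∃[o]m+o≡n c<z
...   | d , refl = <⇒≱ gap (begin
    c * c + 2 * (suc c + d)                             ≤⟨ m≤m+n _ (2 * c * d + d * d) ⟩
    c * c + 2 * (suc c + d) + (2 * c * d + d * d)       ≡⟨ lemma c d ⟩
    (suc c + d) * (suc c + d) + 1                       ∎)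
  where
  open ≤-Reasoning
  lemma : ∀ c d → c * c + 2 * (suc c + d) + (2 * c * d + d * d) ≡ (suc c + d) * (suc c + d) + 1
  lemma = solve-∀

-- The constants 1 and 2 turn the strict inequalities of `between-squares` into `≤`.
sandwiched : Poly → Poly → Bool
sandwiched p z = ((1 ∷ []) +ᵖ p ≤ᵖ z *ᵖ z) ∧ ((2 ∷ []) +ᵖ z *ᵖ z ≤ᵖ p +ᵖ 2 ·ᵖ z)

sandwiched-sound : ∀ p z → T (sandwiched p z) → ∀ x → ¬ Squareℕ (eval x p)
sandwiched-sound p z h x with T-∧⁻ {(1 ∷ []) +ᵖ p ≤ᵖ z *ᵖ z} h
... | below , above = between-squares {eval x z}
  (begin
    suc (eval x p)              ≡⟨ cong (_+ eval x p) (eval-const 1) ⟨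
    eval x (1 ∷ []) + eval x p  ≡⟨ eval-+ x (1 ∷ []) p ⟨
    eval x ((1 ∷ []) +ᵖ p)      ≤⟨ eval-≤ x ((1 ∷ []) +ᵖ p) (z *ᵖ z) below ⟩
    eval x (z *ᵖ z)             ≡⟨ eval-* x z z ⟩
    eval x z * eval x z         ∎)
  (begin
    suc (eval x z * eval x z + 1)      ≡⟨ cong suc (+-comm _ 1) ⟩
    2 + eval x z * eval x z            ≡⟨ cong₂ _+_ (eval-const 2) (eval-* x z z) ⟨
    eval x (2 ∷ []) + eval x (z *ᵖ z)  ≡⟨ eval-+ x (2 ∷ []) (z *ᵖ z) ⟨
    eval x ((2 ∷ []) +ᵖ z *ᵖ z)        ≤⟨ eval-≤ x ((2 ∷ []) +ᵖ z *ᵖ z) (p +ᵖ 2 ·ᵖ z) above ⟩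
    eval x (p +ᵖ 2 ·ᵖ z)               ≡⟨ eval-+ x p (2 ·ᵖ z) ⟩
    eval x p + eval x (2 ·ᵖ z)         ≡⟨ cong (λ y → eval x p + y) (eval-· x 2 z) ⟩
    eval x p + 2 * eval x z            ∎)
  where
  open ≤-Reasoning
  eval-const : ∀ a → eval x (a ∷ []) ≡ a
  eval-const a = trans (cong (λ y → a + y) (*-zeroʳ x)) (+-identityʳ a)

nonSquareModSome : List ℕ → ℕ → Bool
nonSquareModSome []           y = false
nonSquareModSome (zero  ∷ ns) y = false
nonSquareModSome (suc n ∷ ns) y = Residues.nonSquare (suc n) y ∨ nonSquareModSome ns y

nonSquareModSome-sound : ∀ ns {y} → T (nonSquareModSome ns y) → ¬ Squareℕ y
nonSquareModSome-sound (suc n ∷ ns) {y} h =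
  [ (λ t → Residues.nonSquare-sound (suc n) {y} t refl) , nonSquareModSome-sound ns ]′
    (T-∨⁻ {Residues.nonSquare (suc n) y} h)

smallModuli : List ℕ
smallModuli = 8 ∷ 3 ∷ 5 ∷ 7 ∷ 11 ∷ 13 ∷ 17 ∷ 19 ∷ 23 ∷ 29 ∷ 31 ∷ 37 ∷ []

-- (c + x)², as a polynomial in x.
K[_+x] : ℕ → Poly
K[ c +x] = (c ∷ 1 ∷ []) *ᵖ (c ∷ 1 ∷ [])

-- Checks 1 ≤ k ≤ b modulo small primes and k > b by polynomials.
nonSquareAt : ℕ → ℕ → Poly → Bool
nonSquareAt m b z =
  allBelow (λ i → nonSquareModSome smallModuli (proj₁ (state (suc i * suc i) m))) b
    ∧ sandwiched (proj₁ (stateᵖ K[ suc b +x] m)) z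

nonSquareAt-sound : ∀ m b z → T (nonSquareAt m b z) → ∀ k → ¬ Squareℕ (proj₁ (state (suc k * suc k) m))
nonSquareAt-sound m b z h k with T-∧⁻ {allBelow (λ i → nonSquareModSome smallModuli (proj₁ (state (suc i * suc i) m))) b} h | k <? b
... | small , _ | yes k<b = nonSquareModSome-sound smallModuli (allBelow-sound _ b small k k<b)
... | _ , large | no k≮b with m≤n⇒∃[o]m+o≡n (≮⇒≥ k≮b)
-- Here `k = b + x`, while the recurrence is taken at `suc k`, hence the expansion at `suc b`.
...   | x , refl = subst (¬_ ∘ Squareℕ)
  (trans (cong proj₁ (eval-state x K[ suc b +x] m)) (cong (λ K → proj₁ (state K m)) eval-K))
  (sandwiched-sound (proj₁ (stateᵖ K[ suc b +x] m)) z large x)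
  where
  eval-K : eval x K[ suc b +x] ≡ suc (b + x) * suc (b + x)
  eval-K = trans (eval-* x (suc b ∷ 1 ∷ []) (suc b ∷ 1 ∷ [])) (lemma b x)
    where
    lemma : ∀ b x → (suc b + x * (1 + x * 0)) * (suc b + x * (1 + x * 0)) ≡ suc (b + x) * suc (b + x)
    lemma = solve-∀

-- z₀ and z₁ are one more than the truncated square root of a_m as a polynomial in k = c + x, for
-- c = 1, 2. For m = 2 the remainder is negative, so z₂ is the root itself, at c = 1230, the least c
-- for which the comparison of coefficients succeeds. Its constant term −1884 as a polynomial in K
-- is written 172 − 2056 and combined with 2056 K into 172 + 2056 (k − 1)(k + 1).
z₀ z₁ z₂ : Poly
z₀ = (1 ∷ []) +ᵖ 2 ·ᵖ (1 ∷ 1 ∷ [])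
z₁ = (1 ∷ []) +ᵖ (2 ∷ 1 ∷ []) *ᵖ ((5 ∷ 8 ∷ 16 ∷ []) ∘ᵖ K[ 2 +x])
z₂ = (1230 ∷ 1 ∷ []) *ᵖ
  ((172 ∷ []) +ᵖ 2056 ·ᵖ ((1229 ∷ 1 ∷ []) *ᵖ (1231 ∷ 1 ∷ [])) +ᵖ
   (0 ∷ 0 ∷ 16113 ∷ 43296 ∷ 84160 ∷ 128512 ∷ 169472 ∷ 188416 ∷ 180224 ∷ 131072 ∷ 65536 ∷ []) ∘ᵖ K[ 1230 +x])

-- From δ and ε to the recurrence

-- After division by the gcd, `m′` is coprime to `n′` and divides `n′ * n′`. Hence it divides `n′`,
-- so it is 1 and `m` equals the gcd.
m²∣n²⇒m∣n : ∀ m n .{{_ : NonZero m}} → m * m ∣ n * n → m ∣ n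
m²∣n²⇒m∣n m n m²∣n² = subst (_∣ n) (trans (sym (*-identityˡ g)) (trans (cong (_* g) (sym m′≡1)) m≡))
  (gcd[m,n]∣n m n)
  where
  g = gcd m n
  instance
    g-nonZero : NonZero g
    g-nonZero = ℕ.≢-nonZero (gcd[m,n]≢0 m n (inj₁ (ℕ.≢-nonZero⁻¹ m)))
  m′ = m / g
  n′ = n / g
  m≡ : m′ * g ≡ m
  m≡ = m/n*n≡m (gcd[m,n]∣m m n)
  n≡ : n′ * g ≡ n
  n≡ = m/n*n≡m (gcd[m,n]∣n m n)
  square : ∀ x {y} → x * g ≡ y → y * y ≡ x * x * (g * g)
  square x refl = interchange x g
    where
    interchange : ∀ x y → x * y * (x * y) ≡ x * x * (y * y)
    interchange = solve-∀
  m′²∣n′² : m′ * m′ ∣ n′ * n′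
  m′²∣n′² = *-cancelʳ-∣ (g * g) {{m*n≢0 g g}} (subst₂ _∣_ (square m′ m≡) (square n′ n≡) m²∣n²)
  coprime : Coprime m′ n′
  coprime = coprime-/gcd m n
  m′≡1 : m′ ≡ 1
  m′≡1 = coprime (∣-refl , coprime-divisor coprime (∣-trans (m∣m*n m′) m′²∣n′²))

square-cancelˡ : ∀ t {a} .{{_ : NonZero t}} → Squareℕ (t * t * a) → Squareℕ a
square-cancelˡ t {a} (m , m²≡t²a) with m²∣n²⇒m∣n t m (divides a (trans m²≡t²a (*-comm (t * t) a)))
... | divides c refl = c , *-cancelˡ-≡ (c * c) a (t * t) {{m*n≢0 t t}} (trans (interchange t c) m²≡t²a)
  where
  interchange : ∀ t c → t * t * (c * c) ≡ c * t * (c * t)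
  interchange = solve-∀

-- The remainder equals `(i - q) * j` and is smaller than `∣ j ∣`, which forces `i - q` to vanish.
i*j/j≡i : ∀ i j .{{_ : ℤ.NonZero j}} → (i ℤ.* j) ℤ/./ j ≡ i
i*j/j≡i i j = sym (ℤₚ.i-j≡0⇒i≡j i q (ℤₚ.∣i∣≡0⇒i≡0 (n<1⇒n≡0 (*-cancelʳ-< ∣ j ∣ _ 1 (begin-strict
    ∣ i ℤ.- q ∣ * ∣ j ∣      ≡⟨ ℤₚ.abs-* (i ℤ.- q) j ⟨
    ∣ (i ℤ.- q) ℤ.* j ∣      ≡⟨ cong ∣_∣ remainder ⟩
    r                        <⟨ ℤ/.n%d<d (i ℤ.* j) j ⟩
    ∣ j ∣                    ≡⟨ *-identityˡ ∣ j ∣ ⟨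
    1 * ∣ j ∣                ∎)))))
  where
  open ≤-Reasoning
  q = (i ℤ.* j) ℤ/./ j
  r = (i ℤ.* j) ℤ/.% j
  expand : ∀ i j q r → i ℤ.* j ≡ r ℤ.+ q ℤ.* j → (i ℤ.- q) ℤ.* j ≡ r
  expand i j q r eq = trans (distrib i j q) (trans (cong (ℤ._- q ℤ.* j) eq) (cancel r (q ℤ.* j)))
    where
    distrib : ∀ i j q → (i ℤ.- q) ℤ.* j ≡ i ℤ.* j ℤ.- q ℤ.* j
    distrib = ℤ-Ring.solve-∀
    cancel : ∀ r x → r ℤ.+ x ℤ.- x ≡ r
    cancel = ℤ-Ring.solve-∀
  remainder : (i ℤ.- q) ℤ.* j ≡ + r
  remainder = expand i j q (+ r) (ℤ/.a≡a%n+[a/n]*n (i ℤ.* j) j)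

*-≢0 : ∀ {i j} → i ≢ 0ℤ → j ≢ 0ℤ → i ℤ.* j ≢ 0ℤ
*-≢0 {i} i≢0 j≢0 eq = [ i≢0 , j≢0 ]′ (ℤₚ.i*j≡0⇒i≡0∨j≡0 i eq)

normℤ : ∀ a b → + norm (a , b) ≡ + a ℤ.* + a ℤ.+ + b ℤ.* + b
normℤ a b = trans (ℤₚ.pos-+ (a * a) (b * b)) (cong₂ ℤ._+_ (ℤₚ.pos-* a a) (ℤₚ.pos-* b b))

+∣i∣²≡i² : ∀ i → + (∣ i ∣ * ∣ i ∣) ≡ i ℤ.* i
+∣i∣²≡i² (+ n)    = ℤₚ.pos-* n n
+∣i∣²≡i² -[1+ n ] = refl

IsSquare-cancelˡ : ∀ t a → t ≢ 0ℤ → IsSquare (t ℤ.* t ℤ.* + a) → Squareℕ a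
IsSquare-cancelˡ t a t≢0 (m , eq) = square-cancelˡ ∣ t ∣ {{≢-nonZero t≢0}} (∣ m ∣ , (begin
  ∣ m ∣ * ∣ m ∣            ≡⟨ ℤₚ.abs-* m m ⟨
  ∣ m ℤ.* m ∣              ≡⟨ cong ∣_∣ eq ⟩
  ∣ t ℤ.* t ℤ.* + a ∣      ≡⟨ ℤₚ.abs-* (t ℤ.* t) (+ a) ⟩
  ∣ t ℤ.* t ∣ * a          ≡⟨ cong (_* a) (ℤₚ.abs-* t t) ⟩
  ∣ t ∣ * ∣ t ∣ * a        ∎))
  where open ≡-Reasoning

module _ (k : ℤ) (h : k ≢ 0ℤ) where

  private instance
    k-nonZero : ℤ.NonZero k
    k-nonZero = ≢-nonZero h

  -- Replaces the integer division by an explicit quotient: exhibiting `x` with `d * e = x * k`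
  -- shows the division exact.
  δε-suc : ∀ m {d e} x → δε k h (suc m) ≡ (d , e) → d ℤ.* e ≡ x ℤ.* k →
    δε k h (suc (suc m)) ≡ (d ℤ.* d ℤ.+ e ℤ.* e , x)
  δε-suc m x eq de≡xk rewrite eq | de≡xk = cong (_ ,_) (i*j/j≡i x k)

  K : ℕ
  K = ∣ k ∣ * ∣ k ∣

  scaled : ℤ → ℕ × ℕ → ℤ × ℤ
  scaled t (a , b) = t ℤ.* t ℤ.* + a , t ℤ.* t ℤ.* + b

  -- The product of the two coordinates is `t⁴ab`. Writing one factor `t` as `k * u` exposes the `k`
  -- to be divided out.
  δε-odd : ∀ n t u z → t ≡ k ℤ.* u → δε k h (suc n) ≡ scaled t z →
    δε k h (suc (suc n)) ≡
      ( t ℤ.* t ℤ.* (t ℤ.* t) ℤ.* + norm z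
      , t ℤ.* t ℤ.* t ℤ.* u ℤ.* (+ proj₁ z ℤ.* + proj₂ z))
  δε-odd n t u (a , b) t≡ku eq = trans
    (δε-suc n (t ℤ.* t ℤ.* t ℤ.* u ℤ.* (+ a ℤ.* + b)) eq (trans (pull t (+ a) (+ b)) (trans (cong (t ℤ.* t ℤ.* t ℤ.* (+ a ℤ.* + b) ℤ.*_) t≡ku) (push k u (t ℤ.* t ℤ.* t) (+ a ℤ.* + b)))))
    (cong₂ _,_ (trans (collect t (+ a) (+ b)) (cong (t ℤ.* t ℤ.* (t ℤ.* t) ℤ.*_) (sym (normℤ a b)))) refl)
    where
    pull : ∀ t a b → (t ℤ.* t ℤ.* a) ℤ.* (t ℤ.* t ℤ.* b) ≡ t ℤ.* t ℤ.* t ℤ.* (a ℤ.* b) ℤ.* t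
    pull = ℤ-Ring.solve-∀
    push : ∀ k u p c → p ℤ.* c ℤ.* (k ℤ.* u) ≡ p ℤ.* u ℤ.* c ℤ.* k
    push = ℤ-Ring.solve-∀
    collect : ∀ t a b → (t ℤ.* t ℤ.* a) ℤ.* (t ℤ.* t ℤ.* a) ℤ.+ (t ℤ.* t ℤ.* b) ℤ.* (t ℤ.* t ℤ.* b) ≡
      t ℤ.* t ℤ.* (t ℤ.* t) ℤ.* (a ℤ.* a ℤ.+ b ℤ.* b)
    collect = ℤ-Ring.solve-∀

  -- The factor k of t is what makes the next division by k exact.
  δε-even : ∀ m → ∃ λ t → ∃ λ u → t ≢ 0ℤ × u ≢ 0ℤ × t ≡ k ℤ.* u ×
    δε k h (suc (suc (m * 2))) ≡ scaled t (state K m)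
  -- `δ_2 = 4k⁴ + k² = k²(4K + 1)` and `ε_2 = 2k²`, so `t = k` and `u = 1`.
  δε-even zero = k , + 1 , h , (λ ()) , sym (ℤₚ.*-identityʳ k) , trans
    (δε-suc 0 (+ 2 ℤ.* (k ℤ.* k)) refl refl)
    (cong₂ _,_
      (trans (first k) (cong (k ℤ.* k ℤ.*_) (sym initℤ)))
      (ℤₚ.*-comm (+ 2) (k ℤ.* k)))
    where
    first : ∀ k → + 2 ℤ.* (k ℤ.* k) ℤ.* (+ 2 ℤ.* (k ℤ.* k)) ℤ.+ k ℤ.* k ≡
      k ℤ.* k ℤ.* (+ 4 ℤ.* (k ℤ.* k) ℤ.+ + 1)
    first = ℤ-Ring.solve-∀
    initℤ : + (4 * K + 1) ≡ + 4 ℤ.* (k ℤ.* k) ℤ.+ + 1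
    initℤ = trans (ℤₚ.pos-+ (4 * K) 1) (cong (ℤ._+ + 1) (trans (ℤₚ.pos-* 4 K) (cong (+ 4 ℤ.*_) (+∣i∣²≡i² k))))
  δε-even (suc m) with δε-even m
  ... | t , u , t≢0 , u≢0 , t≡ku , eq =
    -- The preceding pair is `(t⁴N, t³uc)` with `t⁴ = t³ku`. Thus `(t³u)²` factors out of both the
    -- sum of squares and the quotient by `k`, and the new scale is `t³u = k(t²u²)`.
    t′ , t ℤ.* t ℤ.* u ℤ.* u , *-≢0 (*-≢0 (*-≢0 t≢0 t≢0) t≢0) u≢0 , *-≢0 (*-≢0 (*-≢0 t≢0 t≢0) u≢0) u≢0 ,
    trans (cong (λ x → t ℤ.* t ℤ.* x ℤ.* u) t≡ku) (regroup k u (t ℤ.* t)) ,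
    trans
      (δε-suc (suc (suc (m * 2))) (t′ ℤ.* t′ ℤ.* (N ℤ.* c)) (δε-odd (suc (m * 2)) t u (state K m) t≡ku eq)
        (trans (cong (λ x → x ℤ.* N ℤ.* (p ℤ.* u ℤ.* c)) t⁴≡) (exact k u p N c)))
      (cong₂ _,_
        (trans (cong (λ x → x ℤ.* N ℤ.* (x ℤ.* N) ℤ.+ p ℤ.* u ℤ.* c ℤ.* (p ℤ.* u ℤ.* c)) t⁴≡)
          (trans (collect k u p N c) (cong (t′ ℤ.* t′ ℤ.*_) (sym a′≡))))
        (cong (t′ ℤ.* t′ ℤ.*_) (sym b′≡)))
    where
    a = proj₁ (state K m)
    b = proj₂ (state K m)
    N = + norm (state K m)
    c = + a ℤ.* + b
    p = t ℤ.* t ℤ.* t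
    t′ = p ℤ.* u
    regroup : ∀ k u s → s ℤ.* (k ℤ.* u) ℤ.* u ≡ k ℤ.* (s ℤ.* u ℤ.* u)
    regroup = ℤ-Ring.solve-∀
    exact : ∀ k u p n c →
      (p ℤ.* (k ℤ.* u) ℤ.* n) ℤ.* (p ℤ.* u ℤ.* c) ≡ p ℤ.* u ℤ.* (p ℤ.* u) ℤ.* (n ℤ.* c) ℤ.* k
    exact = ℤ-Ring.solve-∀
    collect : ∀ k u p n c →
      (p ℤ.* (k ℤ.* u) ℤ.* n) ℤ.* (p ℤ.* (k ℤ.* u) ℤ.* n) ℤ.+ p ℤ.* u ℤ.* c ℤ.* (p ℤ.* u ℤ.* c) ≡
      p ℤ.* u ℤ.* (p ℤ.* u) ℤ.* (k ℤ.* k ℤ.* (n ℤ.* n) ℤ.+ c ℤ.* c)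
    collect = ℤ-Ring.solve-∀
    t⁴≡ : t ℤ.* t ℤ.* (t ℤ.* t) ≡ p ℤ.* (k ℤ.* u)
    t⁴≡ = trans (sym (ℤₚ.*-assoc (t ℤ.* t) t t)) (cong (p ℤ.*_) t≡ku)
    a′≡ : + proj₁ (state K (suc m)) ≡ k ℤ.* k ℤ.* (N ℤ.* N) ℤ.+ c ℤ.* c
    a′≡ = trans (ℤₚ.pos-+ (K * (norm (state K m) * norm (state K m))) (a * b * (a * b))) (cong₂ ℤ._+_
      (trans (ℤₚ.pos-* K (norm (state K m) * norm (state K m))) (cong₂ ℤ._*_ (+∣i∣²≡i² k) (ℤₚ.pos-* (norm (state K m)) (norm (state K m)))))
      (trans (ℤₚ.pos-* (a * b) (a * b)) (cong (λ x → x ℤ.* x) (ℤₚ.pos-* a b))))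
    b′≡ : + proj₂ (state K (suc m)) ≡ N ℤ.* c
    b′≡ = trans (ℤₚ.pos-* (norm (state K m)) (a * b)) (cong (N ℤ.*_) (ℤₚ.pos-* a b))

  even-index : (∀ m → ¬ Squareℕ (proj₁ (state K m))) → ∀ m → ¬ IsSquare (δ k h (suc (suc (m * 2))))
  even-index nonSquare m sq =
    let (t , u , t≢0 , _ , _ , eq) = δε-even m in
    nonSquare m (IsSquare-cancelˡ t (proj₁ (state K m)) t≢0 (subst IsSquare (cong proj₁ eq) sq))

  odd-index : (∀ m → ¬ Squareℕ (norm (state K m))) → ∀ m → ¬ IsSquare (δ k h (suc (suc (suc (m * 2)))))
  odd-index nonSquare m sq =
    let (t , u , t≢0 , _ , t≡ku , eq) = δε-even m in
    nonSquare m (IsSquare-cancelˡ (t ℤ.* t) (norm (state K m)) (*-≢0 t≢0 t≢0)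
      (subst IsSquare (cong proj₁ (δε-odd (suc (m * 2)) t u (state K m) t≡ku eq)) sq))

  δ-nonSquare : (∀ m → ¬ Squareℕ (proj₁ (state K m))) → (∀ m → ¬ Squareℕ (norm (state K m))) →
    ∀ n → 1 ≤ n → ¬ IsSquare (δ k h n)
  δ-nonSquare even odd (suc zero) _ sq =
    -- `δ_1 = 2k²` lies outside the recurrence; 2 is not a square modulo 3.
    2-nonSquare (IsSquare-cancelˡ k 2 h (subst IsSquare (ℤₚ.*-comm (+ 2) (k ℤ.* k)) sq))
    where
    2-nonSquare : ¬ Squareℕ 2
    2-nonSquare = Residues.nonSquare-sound 3 {2} tt refl
  δ-nonSquare even odd (suc (suc n)) _ = by-parity (n % 2) (m%n<n n 2) (m≡m%n+[m/n]*n n 2)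
    where
    by-parity : ∀ r → r < 2 → n ≡ r + n / 2 * 2 → ¬ IsSquare (δ k h (suc (suc n)))
    by-parity zero       _ eq = subst (λ i → ¬ IsSquare (δ k h (suc (suc i)))) (sym eq) (even-index even (n / 2))
    by-parity (suc zero) _ eq = subst (λ i → ¬ IsSquare (δ k h (suc (suc i)))) (sym eq) (odd-index odd (n / 2))
    by-parity (suc (suc _)) (s≤s (s≤s ())) _

-- For negative `k` with nonzero remainder `s` of `∣ k ∣`, the integer residue is `x = p - s`, and
-- `s² + xp = x² + sp` since `x + s = p`.
residue-square : ∀ k p .{{_ : NonZero p}} → (∣ k ∣ * ∣ k ∣) % p ≡ (k ℤ/.%ℕ p * (k ℤ/.%ℕ p)) % p
residue-square (+ n)    p = %-distribˡ-* n n p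
residue-square -[1+ n ] p with suc n % p in eq | m%n<n (suc n) p
... | zero    | _   = trans (%-distribˡ-* (suc n) (suc n) p) (cong (λ x → (x * x) % p) eq)
... | s@(suc _) | s<p = begin
  (suc n * suc n) % p            ≡⟨ %-distribˡ-* (suc n) (suc n) p ⟩
  (suc n % p * (suc n % p)) % p  ≡⟨ cong (λ x → (x * x) % p) eq ⟩
  (s * s) % p                    ≡⟨ [m+kn]%n≡m%n (s * s) x p ⟨
  (s * s + x * p) % p            ≡⟨ cong (_% p) (swap s x p (m∸n+n≡m (<⇒≤ s<p))) ⟩
  (x * x + s * p) % p            ≡⟨ [m+kn]%n≡m%n (x * x) s p ⟩
  (x * x) % p                    ∎
  where
  open ≡-Reasoning
  x = p ∸ s
  swap : ∀ s x p → x + s ≡ p → s * s + x * p ≡ x * x + s * p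
  swap s x _ refl = identity s x
    where
    identity : ∀ s x → s * s + x * (x + s) ≡ x * x + s * (x + s)
    identity = solve-∀

-- The congruences

-- "Odd" refers to the index of `δ`. Modulo 3, `K` is 0 or 1, so neither coordinate ever vanishes:
-- `a_0` and every later `a` are congruent to `K + 1`. Hence the norm is always 2.
odd-nonSquare : ∀ k m → ¬ Squareℕ (norm (state (k * k) m))
odd-nonSquare k m = subst (λ i → ¬ Squareℕ (norm (state (k * k) i))) (+-identityʳ m)
  (nonSquareFrom-sound 0 norm (λ {z} {w} → norm-cong {z} {w}) {K = k * k} {r = k % 3 * (k % 3)} (%-distribˡ-* k k 3)
    (allBelow-sound (λ r → nonSquareFrom 0 norm (r * r)) 3 tt (k % 3) (m%n<n k 3)) m)
  where open Residues 3

-- Starting at 3 admits moduli for which `a_0`, `a_1` or `a_2` is a square residue; those three are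
-- settled over the integers.
lateNonSquare : ∀ n .{{_ : NonZero n}} → ℕ → Bool
lateNonSquare n = Residues.nonSquareFrom n 3 proj₁

δ-nonSquare-mod : ∀ k (h : k ≢ 0ℤ) p .{{_ : NonZero p}} {r} → ∣ k ∣ * ∣ k ∣ % p ≡ r % p →
  T (lateNonSquare p r) → ∀ n → 1 ≤ n → ¬ IsSquare (δ k h n)
δ-nonSquare-mod k h p {r} k²≈r late = δ-nonSquare k h even (odd-nonSquare ∣ k ∣)
  where
  early : ∀ m b z → T (nonSquareAt m b z) → ¬ Squareℕ (proj₁ (state (∣ k ∣ * ∣ k ∣) m))
  early m b z t = subst (λ i → ¬ Squareℕ (proj₁ (state (i * i) m)))
    (suc-pred ∣ k ∣ {{≢-nonZero h}})
    (nonSquareAt-sound m b z t (pred ∣ k ∣))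
  even : ∀ m → ¬ Squareℕ (proj₁ (state (∣ k ∣ * ∣ k ∣) m))
  -- The cutoffs 0, 1 and 1229 are one less than the centres 1, 2 and 1230 of `z₀`, `z₁` and `z₂`.
  even 0 = early 0 0 z₀ tt
  even 1 = early 1 1 z₁ tt
  even 2 = early 2 1229 z₂ tt
  even (suc (suc (suc m))) = subst (λ i → ¬ Squareℕ (proj₁ (state (∣ k ∣ * ∣ k ∣) i))) (+-comm m 3)
    (Residues.nonSquareFrom-sound p 3 proj₁ proj₁ {K = ∣ k ∣ * ∣ k ∣} {r = r} k²≈r late m)

Entry : Set
Entry = ℕ × List ℕ

-- The entries list residues of `k`, whereas the criterion concerns `k²`, hence `r * r`.
tableTest : Entry → Bool
tableTest (zero  , rs) = false
tableTest (suc q , rs) = all (λ r → lateNonSquare (suc q) (r * r)) rs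

δ-nonSquare-entry : ∀ k h e → T (tableTest e) → SatisfiesEntry k e → ∀ n → 1 ≤ n → ¬ IsSquare (δ k h n)
δ-nonSquare-entry k h (suc q , rs) t k∈rs =
  δ-nonSquare-mod k h (suc q) {r = k ℤ/.%ℕ suc q * (k ℤ/.%ℕ suc q)} (residue-square k (suc q))
    (All.lookup (all⁺ (λ r → lateNonSquare (suc q) (r * r)) rs t) k∈rs)

-- Every residue modulo 2 is a square, so modulus 2 itself can never succeed. The check runs over
-- all residues modulo 8, with the even ones excused by the first disjunct.
δ-nonSquare-odd : ∀ k h → ∣ k ∣ * ∣ k ∣ % 2 ≡ 1 → ∀ n → 1 ≤ n → ¬ IsSquare (δ k h n)
δ-nonSquare-odd k h k²-odd = [ (λ r²-even → ⊥-elim (0≢1+n (trans (sym (≡ᵇ⇒≡ (r * r % 2) 0 r²-even)) r²-odd))) , δ-nonSquare-mod k h 8 {r = r * r} k²≈r² ]′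
  (T-∨⁻ {r * r % 2 ≡ᵇ 0} (allBelow-sound (λ r → (r * r % 2 ≡ᵇ 0) ∨ lateNonSquare 8 (r * r)) 8 tt r (m%n<n ∣ k ∣ 8)))
  where
  r = ∣ k ∣ % 8
  k²≈r² : ∣ k ∣ * ∣ k ∣ % 8 ≡ r * r % 8
  k²≈r² = %-distribˡ-* ∣ k ∣ ∣ k ∣ 8
  r²-odd : r * r % 2 ≡ 1
  r²-odd = begin
    r * r % 2               ≡⟨ m∣n⇒o%n%m≡o%m 2 8 (r * r) (divides-refl 4) ⟨
    r * r % 8 % 2           ≡⟨ cong (_% 2) k²≈r² ⟨
    ∣ k ∣ * ∣ k ∣ % 8 % 2   ≡⟨ m∣n⇒o%n%m≡o%m 2 8 (∣ k ∣ * ∣ k ∣) (divides-refl 4) ⟩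
    ∣ k ∣ * ∣ k ∣ % 2       ≡⟨ k²-odd ⟩
    1                       ∎
    where open ≡-Reasoning

δ-nonSquare-table : ∀ k h es → T (all tableTest es) → Any (SatisfiesEntry k) es → ∀ n → 1 ≤ n → ¬ IsSquare (δ k h n)
δ-nonSquare-table k h es t = All.lookupWith (λ {e} → δ-nonSquare-entry k h e) (all⁺ tableTest es t)

δ-nonSquare-congruence : ∀ k h → SatisfiesSomeCongruence k → ∀ n → 1 ≤ n → ¬ IsSquare (δ k h n)
δ-nonSquare-congruence k h (here (here k%2≡1)) =
  δ-nonSquare-odd k h (trans (residue-square k 2) (cong (λ r → r * r % 2) k%2≡1))
δ-nonSquare-congruence k h (there k∈table) =
  δ-nonSquare-table k h (drop 1 congruenceTable) tt k∈table

-- The range 1 ≤ |k| ≤ 10⁶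

-- Pairs (p , residues of k² modulo p).
coveringTable : List Entry
coveringTable =
    (8 , 1 ∷ [])
  ∷ (3 , 1 ∷ [])
  ∷ (5 , 4 ∷ [])
  ∷ (7 , 1 ∷ 4 ∷ [])
  ∷ (11 , 1 ∷ 3 ∷ 4 ∷ [])
  ∷ (13 , 9 ∷ 10 ∷ [])
  ∷ (17 , 1 ∷ 9 ∷ [])
  ∷ (19 , 5 ∷ 11 ∷ 17 ∷ [])
  ∷ (23 , 1 ∷ 12 ∷ 13 ∷ 18 ∷ [])
  ∷ (29 , 4 ∷ 5 ∷ 22 ∷ 28 ∷ [])
  ∷ (31 , 5 ∷ 7 ∷ 10 ∷ 28 ∷ [])
  ∷ (37 , 10 ∷ 11 ∷ 26 ∷ 27 ∷ 28 ∷ 30 ∷ 36 ∷ [])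
  ∷ (41 , 4 ∷ 5 ∷ 20 ∷ 32 ∷ 39 ∷ [])
  ∷ (43 , 11 ∷ 15 ∷ 16 ∷ 24 ∷ 25 ∷ 31 ∷ [])
  ∷ (47 , 3 ∷ 16 ∷ 18 ∷ 27 ∷ 32 ∷ 37 ∷ [])
  ∷ (53 , 4 ∷ 7 ∷ 40 ∷ 42 ∷ 43 ∷ [])
  ∷ (59 , 1 ∷ 5 ∷ 15 ∷ 35 ∷ 49 ∷ [])
  ∷ (61 , 4 ∷ 9 ∷ 27 ∷ 45 ∷ 46 ∷ 48 ∷ [])
  ∷ (67 , 19 ∷ 24 ∷ 29 ∷ 36 ∷ 56 ∷ 59 ∷ [])
  ∷ (71 , 2 ∷ 3 ∷ 19 ∷ 24 ∷ 43 ∷ 45 ∷ 48 ∷ 49 ∷ 50 ∷ [])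
  ∷ (73 , 38 ∷ 50 ∷ 67 ∷ [])
  ∷ (79 , 4 ∷ 5 ∷ 10 ∷ 19 ∷ 22 ∷ 26 ∷ 36 ∷ 38 ∷ 42 ∷ 62 ∷ [])
  ∷ (83 , 16 ∷ 21 ∷ 33 ∷ 48 ∷ [])
  ∷ (89 , 16 ∷ 20 ∷ 34 ∷ 49 ∷ 55 ∷ 78 ∷ 81 ∷ [])
  ∷ (97 , 3 ∷ 11 ∷ 27 ∷ 43 ∷ 47 ∷ 95 ∷ [])
  ∷ (103 , 28 ∷ 61 ∷ 81 ∷ [])
  ∷ (107 , 102 ∷ [])
  ∷ (109 , 34 ∷ 71 ∷ [])
  ∷ (113 , 7 ∷ 25 ∷ 26 ∷ 36 ∷ 81 ∷ 95 ∷ 102 ∷ 105 ∷ 106 ∷ [])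
  ∷ (127 , 21 ∷ [])
  ∷ (131 , 21 ∷ 33 ∷ [])
  ∷ (137 , 36 ∷ 50 ∷ 60 ∷ 68 ∷ 69 ∷ 128 ∷ [])
  ∷ (157 , 105 ∷ 118 ∷ [])
  ∷ (163 , 41 ∷ [])
  ∷ (167 , 121 ∷ [])
  ∷ (173 , 15 ∷ 100 ∷ 150 ∷ [])
  ∷ (179 , 42 ∷ [])
  ∷ (181 , 177 ∷ [])
  ∷ (191 , 120 ∷ [])
  ∷ (193 , 92 ∷ 118 ∷ 126 ∷ 162 ∷ 165 ∷ 189 ∷ [])
  ∷ (197 , 187 ∷ [])
  ∷ (223 , 143 ∷ [])
  ∷ (227 , 75 ∷ 161 ∷ [])
  ∷ (241 , 40 ∷ [])
  ∷ (257 , 52 ∷ [])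
  ∷ (271 , 160 ∷ [])
  ∷ (277 , 208 ∷ [])
  ∷ (281 , 31 ∷ 158 ∷ 241 ∷ [])
  ∷ []

squareIn : ℕ → Entry → Bool
squareIn x (zero    , rs) = false
squareIn x (p@(suc _) , rs) = any (x * x % p ≡ᵇ_) rs

coveringTest : Entry → Bool
coveringTest (zero  , rs) = false
coveringTest (suc q , rs) = all (lateNonSquare (suc q)) rs

-- Whether every r + m t with t < b is covered by an entry of es. The first d moduli split the
-- progression by the residue of t, so that whole residue classes are discarded at once.
covers : ℕ → List Entry → ℕ → ℕ → ℕ → Bool
covers zero    es                  m r b = allBelow (λ i → any (squareIn (r + m * i)) es) b
covers (suc d) []                  m r b = false
covers (suc d) ((zero , _)  ∷ es)  m r b = false
covers (suc d) (e@(p@(suc _) , _) ∷ es) m r b =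
  -- For `t = i + p * j` with `t < b`, the quotient `j` is at most `b / p`; the bound may overshoot
  -- slightly.
  allBelow (λ i → squareIn (r + m * i) e ∨ covers d es (m * p) (r + m * i) (suc (b / p))) p

-- Modulo `p`, the term `r + m * t` depends only on `i = t % p`. So either the head entry catches
-- the whole class, or `t / p` indexes a term of the finer progression.
covers-sound : ∀ d es m r b → T (covers d es m r b) → ∀ {t} → t < b → Any (λ e → T (squareIn (r + m * t) e)) es
covers-sound zero    es m r b h {t} t<b =
  any⁻ (squareIn (r + m * t)) es (allBelow-sound (λ i → any (squareIn (r + m * i)) es) b h t t<b)
covers-sound (suc d) (e@(p@(suc _) , rs) ∷ es) m r b h {t} t<b =
  [ here ∘ subst T same-residue , there ∘ deeper ]′
    (T-∨⁻ {squareIn (r + m * i) e} (allBelow-sound (λ i → squareIn (r + m * i) e ∨ covers d es (m * p) (r + m * i) (suc (b / p))) p h i (m%n<n t p)))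
  where
  i = t % p
  split : r + m * t ≡ r + m * i + m * p * (t / p)
  split = trans (cong (λ x → r + m * x) (m≡m%n+[m/n]*n t p)) (distrib r m i (t / p) p)
    where
    distrib : ∀ r m i j p → r + m * (i + j * p) ≡ r + m * i + m * p * j
    distrib = solve-∀
  residue : (r + m * i) % p ≡ (r + m * t) % p
  residue = begin
    (r + m * i) % p                      ≡⟨ [m+kn]%n≡m%n (r + m * i) (m * (t / p)) p ⟨
    (r + m * i + m * (t / p) * p) % p    ≡⟨ cong (λ x → (r + m * i + x) % p) (swap m (t / p) p) ⟩
    (r + m * i + m * p * (t / p)) % p    ≡⟨ cong (_% p) split ⟨
    (r + m * t) % p                      ∎
    where
    open ≡-Reasoning
    swap : ∀ m j p → m * j * p ≡ m * p * j
    swap = solve-∀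
  same-residue : squareIn (r + m * i) e ≡ squareIn (r + m * t) e
  same-residue = cong (λ x → any (x ≡ᵇ_) rs) (Residues.*-cong-≈ p {r + m * i} {r + m * t} {r + m * i} {r + m * t} residue residue)
  deeper : T (covers d es (m * p) (r + m * i) (suc (b / p))) → Any (λ e → T (squareIn (r + m * t) e)) es
  deeper h = subst (λ x → Any (λ e → T (squareIn x e)) es) (sym split)
    (covers-sound d es (m * p) (r + m * i) (suc (b / p)) h (s≤s (/-monoˡ-≤ p (<⇒≤ t<b))))

δ-nonSquare-covered : ∀ k h e → T (coveringTest e) → T (squareIn ∣ k ∣ e) → ∀ n → 1 ≤ n → ¬ IsSquare (δ k h n)
δ-nonSquare-covered k h (suc q , rs) t k²∈rs =
  δ-nonSquare-mod k h (suc q) {r = ∣ k ∣ * ∣ k ∣ % suc q} (sym (m%n%n≡m%n (∣ k ∣ * ∣ k ∣) (suc q)))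
    (All.lookup (all⁺ (lateNonSquare (suc q)) rs t) (Any.map (λ {x} → ≡ᵇ⇒≡ (∣ k ∣ * ∣ k ∣ % suc q) x) (any⁻ (∣ k ∣ * ∣ k ∣ % suc q ≡ᵇ_) rs k²∈rs)))

δ-nonSquare-covering : ∀ k h es → T (all coveringTest es) → Any (λ e → T (squareIn ∣ k ∣ e)) es → ∀ n → 1 ≤ n → ¬ IsSquare (δ k h n)
δ-nonSquare-covering k h es t = All.lookupWith (λ {e} → δ-nonSquare-covered k h e) (all⁺ coveringTest es t)

million-covered : ∀ k → k < 1000000 → Any (λ e → T (squareIn (1 + 1 * k) e)) coveringTable
-- Splitting by 8, 3, 5, 7 and 11 leaves progressions of difference 9240 with 109 terms each, tested
-- term by term against the remaining entries.
million-covered k = covers-sound 5 coveringTable 1 1 1000000 tt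

δ-nonSquare-small : ∀ k h → ∣ k ∣ ≤ 10 ^ 6 → ∀ n → 1 ≤ n → ¬ IsSquare (δ k h n)
δ-nonSquare-small k h k≤10⁶ =
  δ-nonSquare-covering k h coveringTable tt
    (subst (λ x → Any (λ e → T (squareIn x e)) coveringTable) suc-pred-k
      (million-covered (pred ∣ k ∣)
        (subst (_≤ 1000000) (sym (suc-pred ∣ k ∣ {{≢-nonZero h}})) k≤10⁶)))
  where
  suc-pred-k : 1 + 1 * pred ∣ k ∣ ≡ ∣ k ∣
  suc-pred-k = trans (cong suc (*-identityˡ (pred ∣ k ∣))) (suc-pred ∣ k ∣ {{≢-nonZero h}})

theorem19 : ((k₀ : ℤ) → (h : k₀ ≢ 0ℤ) → SatisfiesSomeCongruence k₀ →
    (n : ℕ) → 1 ≤ n → ¬ IsSquare (δ k₀ h n))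
    × ((k₀ : ℤ) → (h : k₀ ≢ 0ℤ) → 1 ≤ ∣ k₀ ∣ → ∣ k₀ ∣ ≤ 10 ^ 6 →
    (n : ℕ) → 1 ≤ n → ¬ IsSquare (δ k₀ h n))
theorem19 = δ-nonSquare-congruence , λ k₀ h _ → δ-nonSquare-small k₀ h
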